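{- There is no computable set $C\subseteq\mathbb{N}$ with $\mathbf{M}\subseteq C$ and $C\cap E_0=\varnothing$.
   Context: $(\varphi_e)_{e\in\mathbb{N}}$ is a fixed standard acceptable numbering of the unary partial computable functions. $\mathbf{M}=\{p\in\mathbb{N}:\varphi_p(0)\!\downarrow=1\}$ and $E_0=\{p\in\mathbb{N}:\varphi_p(0)\!\downarrow=0\}$. -}

module Defs where

open import Data.Fin.Base using (Fin)
open import Data.Nat.Base using (ℕ; zero; suc; _<_)
open import Data.Nat.Properties using (<-cmp)
open import Data.Product.Base using (∃; ∃-syntax; _×_; _,_)
open import Data.Vec.Base using (Vec; []; _∷_; lookup)
open import Function.Bundles using (_⇔_)
open import Level using (Level; 0ℓ)
open import Relation.Binary.Definitions using (tri<; tri≈; tri>)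
open import Relation.Binary.PropositionalEquality using (_≡_; refl)
open import Relation.Nullary.Negation using (¬_)
open import Relation.Unary using (Pred; _∈_; _∉_)

private variable
  k n : ℕ
  ℓ : Level

-- Partial computable functions ℕᵏ ⇀ ℕ, as Kleene's μ-recursive functions.

data Code : ℕ → Set where
  zer  : Code k
  succ : Code 1
  proj : Fin k → Code k
  comp : Code n → Vec (Code k) n → Code k
  prec : Code k → Code (suc (suc k)) → Code (suc k)
  mini : Code (suc k) → Code k

infix 4 _⟨_⟩↓_ _⟨_⟩⇊_

-- f ⟨ xs ⟩↓ y : the computation of f on input xs halts with output y.
-- fs ⟨ xs ⟩⇊ ys : the same for a list of codes, all run on the input xs.
data _⟨_⟩↓_ : Code k → Vec ℕ k → ℕ → Set
data _⟨_⟩⇊_ : Vec (Code k) n → Vec ℕ k → Vec ℕ n → Set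

data _⟨_⟩↓_ where
  ↓zer   : {xs : Vec ℕ k} → zer ⟨ xs ⟩↓ 0
  ↓succ  : ∀ {x} → succ ⟨ x ∷ [] ⟩↓ suc x
  ↓proj  : {xs : Vec ℕ k} (i : Fin k) → proj i ⟨ xs ⟩↓ lookup xs i
  ↓comp  : {f : Code n} {gs : Vec (Code k) n} {xs : Vec ℕ k} {ys : Vec ℕ n} {z : ℕ} →
           gs ⟨ xs ⟩⇊ ys → f ⟨ ys ⟩↓ z → comp f gs ⟨ xs ⟩↓ z
  ↓prec₀ : {f : Code k} {g : Code (suc (suc k))} {xs : Vec ℕ k} {y : ℕ} →
           f ⟨ xs ⟩↓ y → prec f g ⟨ 0 ∷ xs ⟩↓ y
  ↓precₛ : {f : Code k} {g : Code (suc (suc k))} {m : ℕ} {xs : Vec ℕ k} {y z : ℕ} →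
           prec f g ⟨ m ∷ xs ⟩↓ y → g ⟨ m ∷ y ∷ xs ⟩↓ z →
           prec f g ⟨ suc m ∷ xs ⟩↓ z
  -- All searches below the least zero must converge, to a nonzero value.
  ↓mini  : {f : Code (suc k)} {xs : Vec ℕ k} {m : ℕ} →
           (∀ i → i < m → ∃[ y ] f ⟨ i ∷ xs ⟩↓ suc y) →
           f ⟨ m ∷ xs ⟩↓ 0 → mini f ⟨ xs ⟩↓ m

data _⟨_⟩⇊_ where
  []  : {xs : Vec ℕ k} → [] ⟨ xs ⟩⇊ []
  _∷_ : {f : Code k} {fs : Vec (Code k) n} {xs : Vec ℕ k} {y : ℕ} {ys : Vec ℕ n} →
        f ⟨ xs ⟩↓ y → fs ⟨ xs ⟩⇊ ys → (f ∷ fs) ⟨ xs ⟩⇊ (y ∷ ys)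

↓-functional : {f : Code k} {xs : Vec ℕ k} {y z : ℕ} →
               f ⟨ xs ⟩↓ y → f ⟨ xs ⟩↓ z → y ≡ z
⇊-functional : {fs : Vec (Code k) n} {xs : Vec ℕ k} {ys zs : Vec ℕ n} →
               fs ⟨ xs ⟩⇊ ys → fs ⟨ xs ⟩⇊ zs → ys ≡ zs

↓-functional ↓zer ↓zer = refl
↓-functional ↓succ ↓succ = refl
↓-functional (↓proj i) (↓proj .i) = refl
↓-functional (↓comp p q) (↓comp p′ q′) with refl ← ⇊-functional p p′ = ↓-functional q q′
↓-functional (↓prec₀ p) (↓prec₀ p′) = ↓-functional p p′
↓-functional (↓precₛ p q) (↓precₛ p′ q′) with refl ← ↓-functional p p′ = ↓-functional q q′
↓-functional (↓mini {m = m} h p) (↓mini {m = m′} h′ p′) with <-cmp m m′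
... | tri≈ _ m≡m′ _ = m≡m′
... | tri< m<m′ _ _ with _ , q ← h′ m m<m′ with () ← ↓-functional p q
... | tri> _ _ m′<m with _ , q ← h m′ m′<m with () ← ↓-functional q p′

⇊-functional [] [] = refl
⇊-functional (p ∷ ps) (q ∷ qs)
  with refl ← ↓-functional p q | refl ← ⇊-functional ps qs = refl

-- A partial function ℕᵏ ⇀ ℕ is given by its graph: F xs y means F(xs)↓ = y.
-- Single-valuedness is not required here; being PartialComputable
-- implies it, by ↓-functional.
Graph : ℕ → Set₁
Graph k = Vec ℕ k → ℕ → Set

PartialComputable : Graph k → Set
PartialComputable {k} F = ∃[ c ] (∀ xs y → F xs y ⇔ c ⟨ xs ⟩↓ y)

TotalComputable : (ℕ → ℕ) → Set
TotalComputable h = ∃[ c ] (∀ x → c ⟨ x ∷ [] ⟩↓ h x)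

-- No decidability of C is presupposed: χ is only required to be 1 on C and
-- 0 off C, which is the classical notion of characteristic function.
IsCharacteristicFunction : (ℕ → ℕ) → Pred ℕ ℓ → Set ℓ
IsCharacteristicFunction χ C =
  ∀ x → (x ∈ C → χ x ≡ 1) × (x ∉ C → χ x ≡ 0)

ComputableSet : Pred ℕ ℓ → Set ℓ
ComputableSet C = ∃[ χ ] (TotalComputable χ × IsCharacteristicFunction χ C)

-- A numbering of the unary partial computable functions is acceptable when it
-- satisfies the enumeration (universal function) and s-m-n properties.
record AcceptableNumbering : Set₁ where
  field
    φ          : ℕ → Graph 1
    computable : ∀ e → PartialComputable (φ e)
    surjective : (F : Graph 1) → PartialComputable F →
                 ∃[ e ] (∀ xs y → φ e xs y ⇔ F xs y)
    universal  : ∃[ u ] (∀ e x y → φ e (x ∷ []) y ⇔ u ⟨ e ∷ x ∷ [] ⟩↓ y)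
    smn        : (F : Graph 2) → PartialComputable F →
                 ∃[ s ] (TotalComputable s ×
                         (∀ e x y → φ (s e) (x ∷ []) y ⇔ F (e ∷ x ∷ []) y))

  M : Pred ℕ 0ℓ
  M p = φ p (0 ∷ []) 1

  E₀ : Pred ℕ 0ℓ
  E₀ p = φ p (0 ∷ []) 0

{-# OPTIONS --safe #-}

-- Let φ_{s(e)}(x) = φ_e(e) for all x, by s-m-n and enumeration. If χ were the
-- characteristic function of a computable separating set, then some index e
-- would compute x ↦ isZero (χ (s x)); so p = s(e) satisfies φ_p(0) = 0 when
-- χ p ≠ 0 and φ_p(0) = 1 when χ p = 0, and C misplaces p in either case.
module Submission where

open import Data.Fin.Base using (zero)
open import Data.Nat.Base using (ℕ; zero; suc)
open import Data.Product.Base using (Σ-syntax; ∃-syntax; _×_; _,_)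
open import Data.Vec.Base using ([]; _∷_)
open import Function.Base using (_∘_)
open import Function.Bundles using (module Equivalence)
open import Function.Construct.Identity using (⇔-id)
open import Level using (Level)
open import Relation.Nullary.Negation using (¬_)
open import Relation.Unary using (Pred; _⊆_; _∩_; Empty)
open import Defs

open Equivalence using (to; from)

isZero : ℕ → ℕ
isZero zero    = 1
isZero (suc _) = 0

isZero-computable : TotalComputable isZero
isZero-computable = prec (comp succ (zer ∷ [])) zer , computes
  where
  computes : ∀ x → prec (comp succ (zer ∷ [])) zer ⟨ x ∷ [] ⟩↓ isZero x
  computes zero          = ↓prec₀ (↓comp (↓zer ∷ []) ↓succ)
  computes (suc zero)    = ↓precₛ (computes zero) ↓zer
  computes (suc (suc x)) = ↓precₛ (computes (suc x)) ↓zer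

∘-computable : ∀ {g h} → TotalComputable g → TotalComputable h → TotalComputable (g ∘ h)
∘-computable {h = h} (c , c↓) (d , d↓) =
  comp c (d ∷ []) , λ x → ↓comp (d↓ x ∷ []) (c↓ (h x))

module _ (𝓝 : AcceptableNumbering) where
  open AcceptableNumbering 𝓝

  index : ∀ {h} → TotalComputable h → ∃[ e ] (∀ x → φ e (x ∷ []) (h x))
  index (c , c↓) with e , φₑ⇔c ← surjective (λ xs y → c ⟨ xs ⟩↓ y) (c , λ _ _ → ⇔-id _) =
    e , λ x → from (φₑ⇔c _ _) (c↓ x)

  diagonal : ∃[ s ] (TotalComputable s × (∀ e x y → φ e (e ∷ []) y → φ (s e) (x ∷ []) y))
  diagonal
    with u , φ⇔u ← universal
    -- The code runs `u` on the pair (e, e), whatever the second argument is. The graph given to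
    -- `smn` is its own evaluation relation, hence the identity equivalence.
    with s , s-computable , φₛ⇔ ← smn _ (comp u (proj zero ∷ proj zero ∷ []) , λ _ _ → ⇔-id _) =
    s , s-computable , λ e x y φₑe↓y →
      from (φₛ⇔ e x y) (↓comp (↓proj zero ∷ ↓proj zero ∷ []) (to (φ⇔u e e y) φₑe↓y))

  -- A weak form of Kleene's recursion theorem.
  selfReference : ∀ {h} → TotalComputable h → ∃[ p ] φ p (0 ∷ []) (h p)
  selfReference h-computable
    with s , s-computable , φₛ ← diagonal
    -- With `e` an index of `h ∘ s`, the value of `φ e` at `e` is `h (s e)`, and `φ (s e)` takes
    -- this value everywhere, in particular at 0.
    with e , φₑ ← index (∘-computable h-computable s-computable) =
    s e , φₛ e 0 _ (φₑ e)

corollary7p6 : (𝓝 : AcceptableNumbering) (ℓ : Level) →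
    ¬ (Σ[ C ∈ Pred ℕ ℓ ]
    (ComputableSet C ×
    AcceptableNumbering.M 𝓝 ⊆ C ×
    Empty (C ∩ AcceptableNumbering.E₀ 𝓝)))
corollary7p6 𝓝 ℓ (C , (χ , χ-computable , χ-char) , M⊆C , C∩E₀=∅)
  with p , φₚ0 ← selfReference 𝓝 (∘-computable isZero-computable χ-computable)
  -- The split is on the number `χ p`, as membership in `C` may be undecidable. It also refines
  -- `φₚ0`, to `p ∈ M` for zero and to `p ∈ E₀` otherwise.
  with χ p | χ-char p
... | zero  | χ₁ , _ with () ← χ₁ (M⊆C φₚ0)
... | suc _ | _ , χ₀ with () ← χ₀ (λ p∈C → C∩E₀=∅ p (p∈C , φₚ0))
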